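{- Let $D_1,D_2,\ldots,D_k$ be a collection of $k\ge 2$ pairwise vertex disjoint digraphs with Hamiltonian cycles $C_1,C_2,\ldots,C_k$, respectively, and let $D\in\oplus_{i=1}^k D_i$. If $D$ is strong and contains no good cycle, then $D$ is vertex-pancyclic.
   Context: All paths and cycles are directed. Generalized sum: for pairwise vertex disjoint digraphs $D_1,\ldots,D_k$, $\oplus_{i=1}^k D_i$ is the set of all digraphs $D$ with $V(D)=\bigcup_i V(D_i)$, such that the subdigraph of $D$ induced by $V(D_i)$ is $D_i$ for each $i$, and such that between each pair of vertices lying in different $D_i$'s there is exactly one arc (in one direction). The arcs of $D$ joining vertices of different summands are called exterior arcs; their set is $E_\oplus$. A digraph is strong if for any two distinct vertices $u,v$ there are a directed $uv$-path and a directed $vu$-path. A digraph $D$ of order $N\ge 3$ is vertex-pancyclic if for every vertex $v$ and every $\ell\in\{3,\ldots,N\}$, $D$ contains a directed cycle of length $\ell$ through $v$. An anti-directed 4-cycle is a sequence $v_0v_1v_2v_3v_0$ of four distinct vertices with arcs $(v_0,v_1),(v_0,v_3),(v_2,v_1),(v_2,v_3)\in A(D)$. A good cycle is an anti-directed 4-cycle $v_0v_1v_2v_3v_0$ such that $\{(v_0,v_1),(v_2,v_3)\}\subseteq E_\oplus$ or $\{(v_2,v_1),(v_0,v_3)\}\subseteq E_\oplus$. -}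

module Defs where

open import Data.Nat using (ℕ; zero; suc; _≤_; _%_)
open import Data.Nat.DivMod using (m%n<n)
open import Data.Fin using (Fin; toℕ; fromℕ<)
open import Data.Bool using (Bool; T; false)
open import Data.Product using (Σ; ∃; _×_; _,_)
open import Data.Sum using (_⊎_)
open import Relation.Nullary using (¬_)
open import Relation.Binary.PropositionalEquality using (_≡_; _≢_)
open import Relation.Binary.Construct.Closure.ReflexiveTransitive using (Star)
open import Function.Definitions using (Injective)

Digraph : ℕ → Set
Digraph n = Fin n → Fin n → Bool

Arc : ∀ {n} → Digraph n → Fin n → Fin n → Set
Arc D u v = T (D u v)

Loopless : ∀ {n} → Digraph n → Set
Loopless {n} D = (v : Fin n) → D v v ≡ false

next : ∀ {l} → Fin (suc l) → Fin (suc l)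
next {l} j = fromℕ< (m%n<n (suc (toℕ j)) (suc l))

IsCycle : ∀ {n} → Digraph n → (l : ℕ) → (Fin (suc l) → Fin n) → Set
IsCycle D l c = Injective _≡_ _≡_ c × ((j : Fin (suc l)) → Arc D (c j) (c (next j)))

CycleThrough : ∀ {n} → Digraph n → (l : ℕ) → Fin n → Set
CycleThrough {n} D l v =
  Σ (Fin (suc l) → Fin n) λ c → IsCycle D l c × ∃ λ j → c j ≡ v

-- generalized sum data: part v = index i of the summand D_i containing v;
-- D_i is the subdigraph of D induced by {v | part v ≡ i}.
-- D ∈ ⊕ D_i: exactly one arc between vertices of different summands.
IsGeneralizedSum : ∀ {n k} → Digraph n → (Fin n → Fin k) → Set
IsGeneralizedSum {n} D part =
  (u v : Fin n) → part u ≢ part v →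
    (Arc D u v ⊎ Arc D v u) × ¬ (Arc D u v × Arc D v u)

SummandHamiltonian : ∀ {n k} → Digraph n → (Fin n → Fin k) → Fin k → Set
SummandHamiltonian {n} D part i =
  Σ ℕ λ l → Σ (Fin (suc (suc l)) → Fin n) λ c →
    IsCycle D (suc l) c
    × ((j : Fin (suc (suc l))) → part (c j) ≡ i)
    × ((v : Fin n) → part v ≡ i → ∃ λ j → c j ≡ v)

Exterior : ∀ {n k} → Digraph n → (Fin n → Fin k) → Fin n → Fin n → Set
Exterior D part u v = Arc D u v × part u ≢ part v

Strong : ∀ {n} → Digraph n → Set
Strong {n} D = (u v : Fin n) → u ≢ v → Star (Arc D) u v

AntiDirected4Cycle : ∀ {n} → Digraph n → Fin n → Fin n → Fin n → Fin n → Set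
AntiDirected4Cycle D v0 v1 v2 v3 =
  (v0 ≢ v1 × v0 ≢ v2 × v0 ≢ v3 × v1 ≢ v2 × v1 ≢ v3 × v2 ≢ v3)
  × Arc D v0 v1 × Arc D v0 v3 × Arc D v2 v1 × Arc D v2 v3

GoodCycle : ∀ {n k} → Digraph n → (Fin n → Fin k) → Fin n → Fin n → Fin n → Fin n → Set
GoodCycle D part v0 v1 v2 v3 =
  AntiDirected4Cycle D v0 v1 v2 v3
  × ((Exterior D part v0 v1 × Exterior D part v2 v3)
     ⊎ (Exterior D part v2 v1 × Exterior D part v0 v3))

NoGoodCycle : ∀ {n k} → Digraph n → (Fin n → Fin k) → Set
NoGoodCycle {n} D part = (v0 v1 v2 v3 : Fin n) → ¬ GoodCycle D part v0 v1 v2 v3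

-- vertex-pancyclic (order N = n ≥ 3): every vertex lies on a cycle of
-- every length ℓ ∈ {3, …, n}; a cycle of length ℓ = suc l.
VertexPancyclic : ∀ {n} → Digraph n → Set
VertexPancyclic {n} D =
  3 ≤ n × ((v : Fin n) (l : ℕ) → 2 ≤ l → suc l ≤ n → CycleThrough D l v)

{-# OPTIONS --safe #-}
module Submission where

-- Write x i and y j for the vertices of two summand cycles, of lengths p and q.
-- Since x i, y (j + 1), y j, x (i + 1) is not a good cycle, whether x i → y j
-- depends only on i + j: it is the letter F (i + j) of a word F with periods p
-- and q. The remaining exterior good cycles are the equalities
-- F s = F (s + a) = F (s + b) = F (s + a + b), whose absence forces p = 2 or
-- q = 2 or p = q ∈ {3, 4}. In particular F is not constant, so some y lies on a
-- path x 0 → y → x 1; a third summand would give z with x 0 → z → x 1, and the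
-- arc between y and z would close a good cycle. So k = 2, and cycles of every
-- length are exhibited in each of the three cases.

open import Defs
open import Data.Nat using (ℕ; zero; suc; pred; _+_; _*_; _∸_; _≤_; _<_; z≤n; s≤s; z<s; s<s; _%_; _/_; NonZero; >-nonZero; _<?_)
open import Data.Nat.Properties using (≤-refl; +-mono-≤; ≤-trans; ≤-pred; ≤-<-trans; <⇒≤; <-cmp; +-assoc; +-comm; +-suc; +-identityʳ; *-comm; +-cancelˡ-≡; m≤m+n; m≤m*n; m*n≢0; ≮⇒≥; m∸n≤m; m∸n+n≡m; m<n⇒0<n∸m; m≤n⇒m<n∨m≡n; suc-pred)
open import Data.Nat.DivMod using (m%n<n; m<n⇒m%n≡m; m≡m%n+[m/n]*n; %-distribˡ-+; m%n%n≡m%n; [m+n]%n≡m%n; _mod_)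
open import Data.Nat.Divisibility using (_∣_; divides; ∣m+n∣m⇒∣n; >⇒∤)
open import Data.Nat.Solver using (module +-*-Solver)
open import Data.Fin using (Fin; toℕ; fromℕ<; join; splitAt; zero; suc)
open import Data.Fin.Properties using (toℕ<n; toℕ-fromℕ<; fromℕ<-toℕ; fromℕ<-cong; fromℕ<-injective; toℕ-injective; splitAt-join; injective⇒≤; all?; any?) renaming (_≟_ to _≟ᶠ_)
open import Data.Fin.Patterns using (0F; 1F; 2F; 3F)
open import Data.Bool using (Bool; true; false; not; T; _∧_) renaming (_≟_ to _≟ᵇ_)
open import Data.Bool.Properties using (T-≡; T-∧; ¬-not; ⇔→≡)
open import Data.Product using (Σ; ∃; _×_; _,_; proj₁; proj₂; swap)
open import Data.Sum using (_⊎_; inj₁; inj₂; [_,_]′)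
import Data.Sum.Properties as Sum
open import Data.Vec using (Vec; []; _∷_; lookup)
open import Data.Bool.ListAction using (any)
open import Data.List using (List; []; _∷_)
open import Data.List.Relation.Unary.All as All using (All)
open import Data.List.Relation.Unary.Any as Any using (Any)
open import Data.List.Relation.Unary.Any.Properties using (any⁻; lookup-result)
open import Data.Unit using (tt)
open import Data.Empty using (⊥; ⊥-elim)
open import Function using (_∘_; mk⇔; Equivalence)
open import Relation.Nullary using (¬_; Dec; yes; no; contradiction)
open import Relation.Nullary.Decidable using (isYes; toWitness; _×-dec_; _→-dec_)
open import Relation.Binary.Definitions using (tri<; tri≈; tri>)
open import Relation.Binary.PropositionalEquality using (_≡_; _≢_; refl; sym; trans; cong; subst; subst₂; module ≡-Reasoning)

-- Elementary facts about Booleans, finite sets and residues.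

pigeonhole : (a b c : Bool) → a ≡ b ⊎ b ≡ c ⊎ a ≡ c
pigeonhole true  true  _     = inj₁ refl
pigeonhole false false _     = inj₁ refl
pigeonhole true  false true  = inj₂ (inj₂ refl)
pigeonhole true  false false = inj₂ (inj₁ refl)
pigeonhole false true  true  = inj₂ (inj₁ refl)
pigeonhole false true  false = inj₂ (inj₂ refl)

+-left-comm : ∀ a b c → a + (b + c) ≡ b + (a + c)
+-left-comm a b c = trans (sym (+-assoc a b c)) (trans (cong (_+ c) (+-comm a b)) (+-assoc b a c))

-- A section of `f`, followed by the bijection `join` from the disjoint sum to `Fin (p + q)`, is
-- injective.
surjective⇒≤ : ∀ {p q n} (f : Fin p ⊎ Fin q → Fin n) → (∀ v → ∃ λ c → f c ≡ v) → n ≤ p + q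
surjective⇒≤ {p} {q} f surj = injective⇒≤ injective
  where
  section : Fin _ → Fin p ⊎ Fin q
  section v = proj₁ (surj v)
  injective : ∀ {v w} → join p q (section v) ≡ join p q (section w) → v ≡ w
  injective {v} {w} e = trans (sym (proj₂ (surj v))) (trans (cong f section≡) (proj₂ (surj w)))
    where
    section≡ : section v ≡ section w
    section≡ = trans (sym (splitAt-join p q (section v)))
      (trans (cong (splitAt p) e) (splitAt-join p q (section w)))

≢⇒≡not : ∀ {a b : Bool} → a ≢ b → b ≡ not a
≢⇒≡not a≢b = ¬-not (a≢b ∘ sym)

-- If the residues agreed, `p` would divide `i / p * p + a`, hence `a` itself, which lies strictly
-- between 0 and `p`.
shift-%-≢ : ∀ p .{{_ : NonZero p}} i a → 0 < a → a < p → i % p ≢ (a + i) % p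
shift-%-≢ p i (suc a) _ a<p eq = >⇒∤ a<p (∣m+n∣m⇒∣n p∣ (divides (i / p) refl))
  where
  open +-*-Solver
  open ≡-Reasoning
  r = i % p
  p∣ : p ∣ i / p * p + suc a
  p∣ = divides ((suc a + i) / p) (+-cancelˡ-≡ r _ _ (begin
    r + (i / p * p + suc a)                   ≡⟨ solve 3 (λ r u v → r :+ (u :+ v) := v :+ (r :+ u)) refl r (i / p * p) (suc a) ⟩
    suc a + (r + i / p * p)                   ≡⟨ cong (suc a +_) (sym (m≡m%n+[m/n]*n i p)) ⟩
    suc a + i                                 ≡⟨ m≡m%n+[m/n]*n (suc a + i) p ⟩
    (suc a + i) % p + (suc a + i) / p * p     ≡⟨ cong (_+ (suc a + i) / p * p) (sym eq) ⟩
    r + (suc a + i) / p * p                   ∎))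

-- Rectangles in Boolean words.

-- These are the letters of the four arcs between `x 0`, `x a` and `y s`, `y (b + s)`. For
-- `0 < a < p` and `0 < b < q`, their equality gives a good cycle with all arcs exterior.
Rectangle : (ℕ → Bool) → ℕ → ℕ → ℕ → Set
Rectangle F s a b = F s ≡ F (a + s) × F s ≡ F (b + s) × F s ≡ F (a + (b + s))

rectangle? : ∀ F s a b → Dec (Rectangle F s a b)
rectangle? F s a b = (F s ≟ᵇ F (a + s)) ×-dec (F s ≟ᵇ F (b + s)) ×-dec (F s ≟ᵇ F (a + (b + s)))

-- The value `false` past the end is only a default: `Short` keeps all indices that matter below 8.
at : ∀ {n} → Vec Bool n → ℕ → Bool
at []      _       = false
at (b ∷ _) zero    = b
at (_ ∷ v) (suc m) = at v m

prefix : (ℕ → Bool) → ∀ n → Vec Bool n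
prefix F zero    = []
prefix F (suc n) = F 0 ∷ prefix (F ∘ suc) n

at-prefix : ∀ F {m n} → m < n → at (prefix F n) m ≡ F m
at-prefix F {zero}  (s≤s _)   = refl
at-prefix F {suc m} (s≤s m<n) = at-prefix (F ∘ suc) m<n

allVec : ∀ n → (Vec Bool n → Bool) → Bool
allVec zero    P = P []
allVec (suc n) P = allVec n (P ∘ (false ∷_)) ∧ allVec n (P ∘ (true ∷_))

allVec⁻ : ∀ n P → T (allVec n P) → ∀ v → T (P v)
allVec⁻ zero    P t []          = t
allVec⁻ (suc n) P t (false ∷ v) = allVec⁻ n (P ∘ (false ∷_)) (proj₁ (Equivalence.to T-∧ t)) v
allVec⁻ (suc n) P t (true  ∷ v) = allVec⁻ n (P ∘ (true ∷_)) (proj₂ (Equivalence.to T-∧ t)) v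

-- Triples (s , a , b), found by search, that already meet every word of length 8.
shortRectangles : List (ℕ × ℕ × ℕ)
shortRectangles =
  (0 , 1 , 1) ∷ (1 , 1 , 1) ∷ (2 , 1 , 1) ∷ (3 , 1 , 1) ∷ (4 , 1 , 1) ∷ (5 , 1 , 1) ∷
  (0 , 2 , 2) ∷ (1 , 2 , 2) ∷ (3 , 2 , 2) ∷ (0 , 3 , 3) ∷ (1 , 3 , 3) ∷
  (0 , 1 , 4) ∷ (1 , 1 , 4) ∷ (1 , 2 , 3) ∷ []

Short : ℕ × ℕ × ℕ → Set
Short (s , a , b) =
  (0 < a × a < 5) × (0 < b × b < 5) × (s < 8 × a + s < 8 × b + s < 8 × a + (b + s) < 8)

shortRectangles-short : All Short shortRectangles
shortRectangles-short = toWitness {a? = All.all? short? shortRectangles} tt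
  where
  short? : ∀ t → Dec (Short t)
  short? (s , a , b) =
    ((0 <? a) ×-dec (a <? 5)) ×-dec ((0 <? b) ×-dec (b <? 5)) ×-dec
    ((s <? 8) ×-dec (a + s <? 8) ×-dec (b + s <? 8) ×-dec (a + (b + s) <? 8))

RectangleAt : Vec Bool 8 → ℕ × ℕ × ℕ → Set
RectangleAt v (s , a , b) = Rectangle (at v) s a b

rectangleAt? : ∀ v t → Dec (RectangleAt v t)
rectangleAt? v (s , a , b) = rectangle? (at v) s a b

-- Proof by evaluation: `allVec` runs through all 256 words, and `tt` certifies the outcome.
every-8-word-has-rectangle : ∀ v → Any (RectangleAt v) shortRectangles
every-8-word-has-rectangle v =
  Any.map toWitness (any⁻ (isYes ∘ rectangleAt? v) shortRectangles
    (allVec⁻ 8 (λ v → any (isYes ∘ rectangleAt? v) shortRectangles) tt v))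

-- Only the first eight letters of `F` are inspected. The bound 5 on `a` and `b` makes the rectangle
-- usable for all circuits of size at least 5.
rectangle-exists : ∀ F → ∃ λ s → ∃ λ a → ∃ λ b →
  (0 < a × a < 5) × (0 < b × b < 5) × Rectangle F s a b
rectangle-exists F with every-8-word-has-rectangle (prefix F 8)
... | found with All.lookupAny shortRectangles-short found
... | (a-range , b-range , s< , as< , bs< , abs<) , e₁ , e₂ , e₃ =
  _ , _ , _ , a-range , b-range , transport s< as< e₁ , transport s< bs< e₂ , transport s< abs< e₃
  where
  transport : ∀ {m m′} → m < 8 → m′ < 8 → at (prefix F 8) m ≡ at (prefix F 8) m′ → F m ≡ F m′
  transport m< m′< e = trans (sym (at-prefix F m<)) (trans e (at-prefix F m′<))

-- Explicit cycles for two circuits of equal size 3 or 4.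

Code : ℕ → Set
Code p = Fin p ⊎ Fin p

pattern xᶜ i = inj₁ i
pattern yᶜ j = inj₂ j

-- The arcs known to exist between two circuits of length p when x i → y j
-- is governed by the letter of the cyclic word G at i + j.
module Template {p′ : ℕ} (G : Vec Bool (suc p′)) where
  p : ℕ
  p = suc p′

  _⟶_ : Code p → Code p → Set
  xᶜ i ⟶ xᶜ j = next i ≡ j
  yᶜ i ⟶ yᶜ j = next i ≡ j
  xᶜ i ⟶ yᶜ j = lookup G ((toℕ i + toℕ j) mod p) ≡ true
  yᶜ j ⟶ xᶜ i = lookup G ((toℕ i + toℕ j) mod p) ≡ false

  _⟶?_ : ∀ a b → Dec (a ⟶ b)
  xᶜ i ⟶? xᶜ j = next i ≟ᶠ j
  yᶜ i ⟶? yᶜ j = next i ≟ᶠ j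
  xᶜ i ⟶? yᶜ j = lookup G ((toℕ i + toℕ j) mod p) ≟ᵇ true
  yᶜ j ⟶? xᶜ i = lookup G ((toℕ i + toℕ j) mod p) ≟ᵇ false

  _≟ᶜ_ : (a b : Code p) → Dec (a ≡ b)
  _≟ᶜ_ = Sum.≡-dec _≟ᶠ_ _≟ᶠ_

  CodeCycleThrough : ∀ {l} → Code p → Vec (Code p) (suc l) → Set
  CodeCycleThrough a c =
    ((∀ i j → lookup c i ≡ lookup c j → i ≡ j) × (∀ j → lookup c j ⟶ lookup c (next j)))
    × ∃ λ j → lookup c j ≡ a

  codeCycleThrough? : ∀ {l} a (c : Vec (Code p) (suc l)) → Dec (CodeCycleThrough a c)
  codeCycleThrough? a c =
    (all? (λ i → all? λ j → (lookup c i ≟ᶜ lookup c j) →-dec (i ≟ᶠ j))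
      ×-dec all? (λ j → lookup c j ⟶? lookup c (next j)))
    ×-dec any? (λ j → lookup c j ≟ᶜ a)

  -- A single short cycle cannot meet every vertex, hence a list of cycles that together do.
  Spanning : ∀ {l} → List (Vec (Code p) (suc l)) → Set
  Spanning cs = (∀ i → Any (CodeCycleThrough (xᶜ i)) cs) × (∀ j → Any (CodeCycleThrough (yᶜ j)) cs)

  spanning? : ∀ {l} (cs : List (Vec (Code p) (suc l))) → Dec (Spanning cs)
  spanning? cs = all? (λ i → Any.any? (codeCycleThrough? (xᶜ i)) cs)
    ×-dec all? (λ j → Any.any? (codeCycleThrough? (yᶜ j)) cs)

-- The normal form for size 3: a nonconstant word of period 3 becomes this one by rotation, after
-- exchanging the two circuits (which complements letters) if two of its letters are `true`.
word-3 : Vec Bool 3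
word-3 = true ∷ false ∷ false ∷ []

-- The normal form for size 4: letters at distance 2 differ, so rotating a drop to the front
-- determines all four.
word-4 : Vec Bool 4
word-4 = true ∷ false ∷ false ∷ true ∷ []

spanning-3-3 : Template.Spanning word-3 (
  (xᶜ 0F ∷ xᶜ 1F ∷ xᶜ 2F ∷ []) ∷
  (yᶜ 0F ∷ yᶜ 1F ∷ yᶜ 2F ∷ []) ∷ [])
spanning-3-3 = toWitness {a? = Template.spanning? word-3 _} tt

spanning-3-4 : Template.Spanning word-3 (
  (xᶜ 0F ∷ xᶜ 1F ∷ xᶜ 2F ∷ yᶜ 1F ∷ []) ∷
  (xᶜ 0F ∷ yᶜ 0F ∷ xᶜ 1F ∷ yᶜ 2F ∷ []) ∷ [])
spanning-3-4 = toWitness {a? = Template.spanning? word-3 _} tt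

spanning-3-5 : Template.Spanning word-3 (
  (xᶜ 0F ∷ xᶜ 1F ∷ xᶜ 2F ∷ yᶜ 1F ∷ yᶜ 2F ∷ []) ∷
  (xᶜ 0F ∷ xᶜ 1F ∷ yᶜ 2F ∷ yᶜ 0F ∷ xᶜ 2F ∷ []) ∷ [])
spanning-3-5 = toWitness {a? = Template.spanning? word-3 _} tt

spanning-3-6 : Template.Spanning word-3 (
  (xᶜ 0F ∷ xᶜ 1F ∷ yᶜ 2F ∷ yᶜ 0F ∷ xᶜ 2F ∷ yᶜ 1F ∷ []) ∷ [])
spanning-3-6 = toWitness {a? = Template.spanning? word-3 _} tt

spanning-4-3 : Template.Spanning word-4 (
  (xᶜ 0F ∷ xᶜ 1F ∷ yᶜ 2F ∷ []) ∷
  (xᶜ 0F ∷ yᶜ 0F ∷ yᶜ 1F ∷ []) ∷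
  (xᶜ 0F ∷ yᶜ 3F ∷ xᶜ 3F ∷ []) ∷
  (xᶜ 1F ∷ xᶜ 2F ∷ yᶜ 1F ∷ []) ∷ [])
spanning-4-3 = toWitness {a? = Template.spanning? word-4 _} tt

spanning-4-4 : Template.Spanning word-4 (
  (xᶜ 0F ∷ xᶜ 1F ∷ xᶜ 2F ∷ xᶜ 3F ∷ []) ∷
  (yᶜ 0F ∷ yᶜ 1F ∷ yᶜ 2F ∷ yᶜ 3F ∷ []) ∷ [])
spanning-4-4 = toWitness {a? = Template.spanning? word-4 _} tt

spanning-4-5 : Template.Spanning word-4 (
  (xᶜ 0F ∷ xᶜ 1F ∷ xᶜ 2F ∷ xᶜ 3F ∷ yᶜ 1F ∷ []) ∷
  (xᶜ 0F ∷ yᶜ 3F ∷ yᶜ 0F ∷ xᶜ 1F ∷ yᶜ 2F ∷ []) ∷ [])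
spanning-4-5 = toWitness {a? = Template.spanning? word-4 _} tt

spanning-4-6 : Template.Spanning word-4 (
  (xᶜ 0F ∷ xᶜ 1F ∷ xᶜ 2F ∷ xᶜ 3F ∷ yᶜ 0F ∷ yᶜ 1F ∷ []) ∷
  (xᶜ 0F ∷ xᶜ 1F ∷ xᶜ 2F ∷ yᶜ 2F ∷ yᶜ 3F ∷ xᶜ 3F ∷ []) ∷ [])
spanning-4-6 = toWitness {a? = Template.spanning? word-4 _} tt

spanning-4-7 : Template.Spanning word-4 (
  (xᶜ 0F ∷ xᶜ 1F ∷ xᶜ 2F ∷ xᶜ 3F ∷ yᶜ 0F ∷ yᶜ 1F ∷ yᶜ 2F ∷ []) ∷
  (xᶜ 0F ∷ xᶜ 1F ∷ xᶜ 2F ∷ yᶜ 1F ∷ yᶜ 2F ∷ yᶜ 3F ∷ xᶜ 3F ∷ []) ∷ [])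
spanning-4-7 = toWitness {a? = Template.spanning? word-4 _} tt

spanning-4-8 : Template.Spanning word-4 (
  (xᶜ 0F ∷ xᶜ 1F ∷ xᶜ 2F ∷ yᶜ 2F ∷ yᶜ 3F ∷ xᶜ 3F ∷ yᶜ 0F ∷ yᶜ 1F ∷ []) ∷ [])
spanning-4-8 = toWitness {a? = Template.spanning? word-4 _} tt

-- Cycles and circuits as sequences indexed by natural numbers.

-- The closing arc is a separate hypothesis, so that constructions of cycles need not compute with
-- the modulus in `next`.
closedWalk-cycle : ∀ {n} (D : Digraph n) l (g : ℕ → Fin n) →
  (∀ i → i < l → Arc D (g i) (g (suc i))) → Arc D (g l) (g 0) →
  (∀ i j → i < j → j ≤ l → g i ≢ g j) →
  ∀ i → i ≤ l → CycleThrough D l (g i)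
closedWalk-cycle D l g step close distinct i i≤l =
  g ∘ toℕ , (injective , arcs) , fromℕ< (s≤s i≤l) , cong g (toℕ-fromℕ< (s≤s i≤l))
  where
  injective : ∀ {a b} → g (toℕ a) ≡ g (toℕ b) → a ≡ b
  injective {a} {b} e with <-cmp (toℕ a) (toℕ b)
  ... | tri< a<b _ _ = contradiction e (distinct _ _ a<b (≤-pred (toℕ<n b)))
  ... | tri≈ _ a≡b _ = toℕ-injective a≡b
  ... | tri> _ _ b<a = contradiction (sym e) (distinct _ _ b<a (≤-pred (toℕ<n a)))
  toℕ-next : ∀ (a : Fin (suc l)) → toℕ (next a) ≡ suc (toℕ a) % suc l
  toℕ-next a = toℕ-fromℕ< (m%n<n (suc (toℕ a)) (suc l))
  arcs : ∀ a → Arc D (g (toℕ a)) (g (toℕ (next a)))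
  arcs a with m≤n⇒m<n∨m≡n (≤-pred (toℕ<n a))
  ... | inj₁ a<l = subst (Arc D (g (toℕ a)) ∘ g) (sym (trans (toℕ-next a) (m<n⇒m%n≡m (s≤s a<l)))) (step _ a<l)
  ... | inj₂ a≡l = subst₂ (λ s t → Arc D (g s) (g t)) (sym a≡l)
    (sym (trans (toℕ-next a) (trans (cong (λ m → suc m % suc l) a≡l) ([m+n]%n≡m%n 0 (suc l))))) close

module _ {n k : ℕ} (D : Digraph n) (part : Fin n → Fin k) where

  -- A Hamiltonian cycle of a summand unrolled to a periodic sequence, so that indices of circuits
  -- of different sizes can be added without reduction.
  record Circuit (u : Fin k) (p : ℕ) : Set where
    field
      vertex   : ℕ → Fin n
      2≤size   : 2 ≤ p
      arc      : ∀ i → Arc D (vertex i) (vertex (suc i))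
      periodic : ∀ i → vertex (p + i) ≡ vertex i
      distinct : ∀ i a → 0 < a → a < p → vertex i ≢ vertex (a + i)
      inPart   : ∀ i → part (vertex i) ≡ u

    size-nonZero : NonZero p
    size-nonZero = >-nonZero (≤-trans (s≤s z≤n) 2≤size)

    multi-periodic : ∀ m i → vertex (m * p + i) ≡ vertex i
    multi-periodic zero    i = refl
    multi-periodic (suc m) i =
      trans (cong vertex (+-assoc p (m * p) i)) (trans (periodic (m * p + i)) (multi-periodic m i))

    vertex-% : .{{_ : NonZero p}} → ∀ i → vertex (i % p) ≡ vertex i
    vertex-% i = trans (sym (multi-periodic (i / p) (i % p)))
      (cong vertex (trans (+-comm (i / p * p) (i % p)) (sym (m≡m%n+[m/n]*n i p))))

    window-distinct : ∀ s {i j} → i < j → j < p → vertex (i + s) ≢ vertex (j + s)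
    window-distinct s {i} {j} i<j j<p e =
      distinct (i + s) (j ∸ i) (m<n⇒0<n∸m i<j) (≤-<-trans (m∸n≤m j i) j<p)
        (trans e (cong vertex (trans (cong (_+ s) (sym (m∸n+n≡m (<⇒≤ i<j)))) (+-assoc (j ∸ i) i s))))

    first-distinct : ∀ a → 0 < a → a < p → vertex 0 ≢ vertex a
    first-distinct a 0<a a<p e = distinct 0 a 0<a a<p (trans e (cong vertex (sym (+-identityʳ a))))

    vertex-+0 : ∀ {a b} → vertex a ≡ vertex b → vertex (a + 0) ≡ vertex (b + 0)
    vertex-+0 {a} {b} e = trans (cong vertex (+-identityʳ a)) (trans e (cong vertex (sym (+-identityʳ b))))

    vertex-injective : ∀ (i j : Fin p) → vertex (toℕ i) ≡ vertex (toℕ j) → i ≡ j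
    vertex-injective i j e with <-cmp (toℕ i) (toℕ j)
    ... | tri≈ _ i≡j _ = toℕ-injective i≡j
    ... | tri< i<j _ _ = contradiction (vertex-+0 e) (window-distinct 0 i<j (toℕ<n j))
    ... | tri> _ _ j<i = contradiction (vertex-+0 (sym e)) (window-distinct 0 j<i (toℕ<n i))

  open Circuit

  rotate : ∀ {u p} → ℕ → Circuit u p → Circuit u p
  rotate s X = record
    { vertex   = λ i → vertex X (i + s)
    ; 2≤size   = 2≤size X
    ; arc      = λ i → arc X (i + s)
    ; periodic = λ i → trans (cong (vertex X) (+-assoc _ i s)) (periodic X (i + s))
    ; distinct = λ i a 0<a a<p e →
        distinct X (i + s) a 0<a a<p (trans e (cong (vertex X) (+-assoc a i s)))
    ; inPart   = λ i → inPart X (i + s)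
    }

  rotate-covers : ∀ {u p} s (X : Circuit u p) i → ∃ λ j → vertex (rotate s X) j ≡ vertex X i
  -- Since `p` is nonzero, `s ≤ s * p + i`, so the truncated subtraction is exact; adding `s * p` is
  -- harmless by periodicity.
  rotate-covers {p = p} s X i = s * p + i ∸ s , trans
    (cong (vertex X) (m∸n+n≡m (≤-trans (m≤m*n s p {{size-nonZero X}}) (m≤m+n (s * p) i))))
    (multi-periodic X s i)

  Covers : ∀ {u p} → Circuit u p → Set
  Covers {u} {p} X = ∀ v → part v ≡ u → ∃ λ i → i < p × vertex X i ≡ v

  summand-circuit : ∀ {u} → SummandHamiltonian D part u → ∃ λ p → Σ (Circuit u p) Covers
  summand-circuit (l , c , (inj , arcs) , inU , covers) = p , circuit , λ v v∈u →
    toℕ (proj₁ (covers v v∈u)) , toℕ<n _ , trans (cong c (index-toℕ _)) (proj₂ (covers v v∈u))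
    where
    p = suc (suc l)
    index : ℕ → Fin p
    index i = fromℕ< (m%n<n i p)
    index-cong : ∀ i j → i % p ≡ j % p → index i ≡ index j
    index-cong i j e = fromℕ<-cong _ _ e (m%n<n i p) (m%n<n j p)
    index-toℕ : ∀ j → index (toℕ j) ≡ j
    index-toℕ j = trans (fromℕ<-cong _ _ (m<n⇒m%n≡m (toℕ<n j)) (m%n<n (toℕ j) p) (toℕ<n j)) (fromℕ<-toℕ j (toℕ<n j))
    next-index : ∀ i → next (index i) ≡ index (suc i)
    next-index i = index-cong (suc (toℕ (index i))) (suc i) (begin
      suc (toℕ (index i)) % p        ≡⟨ cong (λ m → suc m % p) (toℕ-fromℕ< (m%n<n i p)) ⟩
      (1 + i % p) % p                ≡⟨ %-distribˡ-+ 1 (i % p) p ⟩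
      (1 % p + i % p % p) % p        ≡⟨ cong (λ m → (1 % p + m) % p) (m%n%n≡m%n i p) ⟩
      (1 % p + i % p) % p            ≡⟨ sym (%-distribˡ-+ 1 i p) ⟩
      suc i % p                      ∎)
      where open ≡-Reasoning
    circuit : Circuit _ p
    circuit = record
      { vertex   = c ∘ index
      ; 2≤size   = s≤s (s≤s z≤n)
      ; arc      = λ i → subst (Arc D (c (index i)) ∘ c) (next-index i) (arcs (index i))
      ; periodic = λ i → cong c (index-cong (p + i) i (trans (cong (_% p) (+-comm p i)) ([m+n]%n≡m%n i p)))
      ; distinct = λ i a 0<a a<p e → shift-%-≢ p i a 0<a a<p
          (fromℕ<-injective _ _ (m%n<n i p) (m%n<n (a + i) p) (inj e))
      ; inPart   = λ i → inU (index i)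
      }

  -- The word of a pair of circuits in the absence of good cycles.

  module NoGood (sum : IsGeneralizedSum D part) (noGood : NoGoodCycle D part) where

    reverse-arc : ∀ {u v} → part u ≢ part v → D v u ≡ not (D u v)
    reverse-arc {u} {v} h with D u v | D v u | sum u v h
    ... | true  | true  | _ , ¬both = ⊥-elim (¬both _)
    ... | true  | false | _ = refl
    ... | false | true  | _ = refl
    ... | false | false | inj₁ () , _
    ... | false | false | inj₂ () , _

    arc⁺ : ∀ {u v} → D u v ≡ true → Arc D u v
    arc⁺ = Equivalence.from T-≡

    module Pair {u w p q} (u≢w : u ≢ w) (X : Circuit u p) (Y : Circuit w q) where
      x y : ℕ → Fin n
      x = vertex X
      y = vertex Y

      private instance
        p≢0 : NonZero p
        p≢0 = size-nonZero X
        q≢0 : NonZero q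
        q≢0 = size-nonZero Y

      exterior : ∀ i j → part (x i) ≢ part (y j)
      exterior i j e = u≢w (trans (sym (inPart X i)) (trans e (inPart Y j)))

      x≢y : ∀ i j → x i ≢ y j
      x≢y i j e = exterior i j (cong part e)

      F : ℕ → Bool
      F s = D (x 0) (y s)

      -- Otherwise x i, y (suc j), y j, x (suc i) is a good cycle, merging the two circuits.
      slide₁ : ∀ i j → D (x i) (y (suc j)) ≡ true → D (x (suc i)) (y j) ≡ true
      slide₁ i j e with D (x (suc i)) (y j) in e′
      ... | true  = refl
      ... | false = ⊥-elim (noGood (x i) (y (suc j)) (y j) (x (suc i))
        (((x≢y i (suc j) , x≢y i j , distinct X i 1 z<s (2≤size X)
         , distinct Y j 1 z<s (2≤size Y) ∘ sym , x≢y (suc i) (suc j) ∘ sym , x≢y (suc i) j ∘ sym)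
        , arc⁺ e , arc X i , arc Y j , yx)
        , inj₁ ((arc⁺ e , exterior i (suc j)) , (yx , exterior (suc i) j ∘ sym))))
        where yx = arc⁺ (trans (reverse-arc (exterior (suc i) j)) (cong not e′))

      slide : ∀ t i j → D (x i) (y (t + j)) ≡ true → D (x (t + i)) (y j) ≡ true
      slide zero    i j e = e
      slide (suc t) i j e =
        subst (λ m → D (x m) (y j) ≡ true) (+-suc t i) (slide t (suc i) j (slide₁ i (t + j) e))

      -- Going once around the torus ℤ/p × ℤ/q turns slide₁ into its converse.
      slide₁⁻ : ∀ i j → D (x (suc i)) (y j) ≡ true → D (x i) (y (suc j)) ≡ true
      slide₁⁻ i j e = subst (λ v → D v (y (suc j)) ≡ true) x-eq
        (slide t (suc i) (suc j) (subst (λ v → D (x (suc i)) v ≡ true) (sym y-eq) e))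
        where
        t = pred (q * p)
        t+1 : suc t ≡ q * p
        t+1 = suc-pred (q * p) {{m*n≢0 q p}}
        x-eq : x (t + suc i) ≡ x i
        x-eq = trans (cong x (trans (+-suc t i) (cong (_+ i) t+1))) (multi-periodic X q i)
        y-eq : y (t + suc j) ≡ y j
        y-eq = trans (cong y (trans (+-suc t j) (cong (_+ j) (trans t+1 (*-comm q p))))) (multi-periodic Y p j)

      diagonal : ∀ i j → D (x i) (y j) ≡ F (i + j)
      diagonal zero    j = refl
      diagonal (suc i) j = trans (⇔→≡ {z = true} (mk⇔ (slide₁⁻ i j) (slide₁ i j)))
        (trans (diagonal i (suc j)) (cong F (+-suc i j)))

      diagonal-reverse : ∀ i j → D (y j) (x i) ≡ not (F (i + j))
      diagonal-reverse i j = trans (reverse-arc (exterior i j)) (cong not (diagonal i j))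

      arc-xy : ∀ i j → F (i + j) ≡ true → Arc D (x i) (y j)
      arc-xy i j e = arc⁺ (trans (diagonal i j) e)

      arc-yx : ∀ i j → F (i + j) ≡ false → Arc D (y j) (x i)
      arc-yx i j e = arc⁺ (trans (diagonal-reverse i j) (cong not e))

      F-p : ∀ s → F (p + s) ≡ F s
      F-p s = trans (sym (diagonal p s)) (cong (λ v → D v (y s)) (trans (cong x (sym (+-identityʳ p))) (periodic X 0)))

      F-q : ∀ s → F (q + s) ≡ F s
      F-q s = cong (D (x 0)) (periodic Y s)

      F-multi-p : ∀ m s → F (m * p + s) ≡ F s
      F-multi-p zero    s = refl
      F-multi-p (suc m) s = trans (cong F (+-assoc p (m * p) s)) (trans (F-p (m * p + s)) (F-multi-p m s))

      -- If the common letter is `true`, both `x 0` and `x a` send arcs to `y s` and `y (b + s)`; if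
      -- it is `false`, all four arcs are reversed. Either way they form an anti-directed 4-cycle.
      no-rectangle : ∀ s a b → 0 < a → a < p → 0 < b → b < q → ¬ Rectangle F s a b
      no-rectangle s a b 0<a a<p 0<b b<q (e₁ , e₂ , e₃) with F s in e
      ... | true  = noGood (x 0) (y s) (x a) (y (b + s))
        (((x≢y 0 s , x₀≢xₐ , x≢y 0 (b + s) , x≢y a s ∘ sym , distinct Y s b 0<b b<q , x≢y a (b + s))
        , A₁ , arc-xy 0 (b + s) (sym e₂) , arc-xy a s (sym e₁) , A₂)
        , inj₁ ((A₁ , exterior 0 s) , (A₂ , exterior a (b + s))))
        where
        x₀≢xₐ = first-distinct X a 0<a a<p
        A₁ = arc-xy 0 s e
        A₂ = arc-xy a (b + s) (sym e₃)
      ... | false = noGood (y s) (x 0) (y (b + s)) (x a)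
        (((x≢y 0 s ∘ sym , distinct Y s b 0<b b<q , x≢y a s ∘ sym , x≢y 0 (b + s) , x₀≢xₐ , x≢y a (b + s) ∘ sym)
        , A₁ , arc-yx a s (sym e₁) , arc-yx 0 (b + s) (sym e₂) , A₂)
        , inj₁ ((A₁ , exterior 0 s ∘ sym) , (A₂ , exterior a (b + s) ∘ sym)))
        where
        x₀≢xₐ = first-distinct X a 0<a a<p
        A₁ = arc-yx 0 s e
        A₂ = arc-yx a (b + s) (sym e₃)

      -- A discrete intermediate value argument: walking `d` steps from a `true` letter to a `false`
      -- one, some single step must fall.
      drop-before : ∀ d s → F s ≡ true → F (d + s) ≡ false → ∃ λ t → F t ≡ true × F (suc t) ≡ false
      drop-before zero    s t f with () ← trans (sym t) f
      drop-before (suc d) s t f with F (suc s) in e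
      ... | false = s , t , e
      ... | true  = drop-before d (suc s) e (trans (cong F (+-suc d s)) f)

      drop-between : ∀ s r → F s ≡ true → F r ≡ false → ∃ λ t → F t ≡ true × F (suc t) ≡ false
      -- By periodicity `r` may be replaced by `s * p + r`, which does not precede `s`.
      drop-between s r t f = drop-before (s * p + r ∸ s) s t
        (trans (cong F (m∸n+n≡m (≤-trans (m≤m*n s p) (m≤m+n (s * p) r)))) (trans (F-multi-p s r) f))

      drop : ∃ λ t → F t ≡ true × F (suc t) ≡ false
      drop with F 0 in e₀ | F 1 in e₁ | F 2 in e₂
      ... | true  | false | _     = drop-between 0 1 e₀ e₁
      ... | true  | true  | false = drop-between 0 2 e₀ e₂
      ... | false | true  | _     = drop-between 1 0 e₁ e₀
      ... | false | false | true  = drop-between 2 0 e₂ e₀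
      -- `Rectangle F 0 1 1` involves only `F 0`, `F 1` and `F 2`, so these letters cannot all
      -- agree.
      ... | true  | true  | true  = ⊥-elim (no-rectangle 0 1 1 z<s (2≤size X) z<s (2≤size Y)
        (trans e₀ (sym e₁) , trans e₀ (sym e₁) , trans e₀ (sym e₂)))
      ... | false | false | false = ⊥-elim (no-rectangle 0 1 1 z<s (2≤size X) z<s (2≤size Y)
        (trans e₀ (sym e₁) , trans e₀ (sym e₁) , trans e₀ (sym e₂)))

      -- At a drop `t`, the letter `F t` orients `x 0` to `y t` and the letter `F (1 + t)` orients
      -- `y t` to `x 1`.
      between : ∃ λ j → Arc D (x 0) (y j) × Arc D (y j) (x 1)
      between with drop
      ... | t , e , e′ = t , arc-xy 0 t e , arc-yx 1 t e′

      -- If `p < q`, then `b = p` is an admissible shift. As `F` has period `p`, the rectangle then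
      -- reduces to `F s = F (a + s)`, so `F 0`, `F 1`, `F 2` would be three distinct Booleans.
      ≮q : 3 ≤ p → ¬ p < q
      ≮q 3≤p p<q = [ apart 0 1 z<s (≤-trans (s≤s (s≤s z≤n)) 3≤p)
                   , [ apart 1 1 z<s (≤-trans (s≤s (s≤s z≤n)) 3≤p) , apart 0 2 z<s 3≤p ]′ ]′
                   (pigeonhole (F 0) (F 1) (F 2))
        where
        apart : ∀ s a → 0 < a → a < p → F s ≢ F (a + s)
        apart s a 0<a a<p e = no-rectangle s a p 0<a a<p (<⇒≤ (2≤size X)) p<q
          (e , sym (F-p s) , trans e (trans (sym (F-p (a + s))) (cong F (+-left-comm p a s))))

      <5 : p ≡ q → p < 5
      <5 refl with p <? 5
      ... | yes p<5 = p<5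
      ... | no  p≮5 with rectangle-exists F
      ...   | s , a , b , (0<a , a<5) , (0<b , b<5) , rect =
        ⊥-elim (no-rectangle s a b 0<a (≤-trans a<5 5≤p) 0<b (≤-trans b<5 5≤p) rect)
        where 5≤p = ≮⇒≥ p≮5

      Pancyclic : Set
      Pancyclic = ∀ l → 2 ≤ l → suc l ≤ p + q →
        (∀ i → CycleThrough D l (x i)) × (∀ j → CycleThrough D l (y j))

    -- One circuit of size 2.

    module SizeTwo {u w q} (u≢w : u ≢ w) (X : Circuit u 2) (Y : Circuit w q) where
      open Pair u≢w X Y

      -- With `a = b = 1` the last corner `F (2 + s)` is `F s` again, so equality of neighbouring
      -- letters alone would give a rectangle.
      alternating : ∀ s → F (suc s) ≡ not (F s)
      alternating s = ≢⇒≡not λ e → no-rectangle s 1 1 z<s ≤-refl z<s (2≤size Y) (e , e , sym (F-p s))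

      y-window : ∀ j {a b} → a < b → b < q → y (a + j) ≢ y (b + j)
      y-window = window-distinct Y

      -- x i → y j → y (1 + j) → ⋯ → y (l - 1 + j) → x i
      odd-cycle : ∀ i j l → F (i + j) ≡ true → F (l + (i + j)) ≡ true → 2 ≤ l → l ≤ suc q →
        CycleThrough D l (x i) × CycleThrough D l (y j)
      odd-cycle i j 1 _ _ (s≤s ()) _
      odd-cycle i j l@(suc (suc l′)) e f _ l≤1+q =
        cycle 0 z≤n , cycle 1 (s≤s z≤n)
        where
        -- The cycle uses `l` consecutive vertices of `Y`, which are distinct only if `l ≤ q`. The
        -- value `l = 1 + q` is excluded because going once around `Y` keeps the letter and one more
        -- step flips it.
        l≤q : l ≤ q
        l≤q with m≤n⇒m<n∨m≡n l≤1+q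
        ... | inj₁ l<1+q = ≤-pred l<1+q
        ... | inj₂ refl with () ←
          trans (sym f) (trans (alternating (q + (i + j))) (cong not (trans (F-q (i + j)) e)))
        g : ℕ → Fin n
        g zero    = x i
        g (suc m) = y (m + j)
        step : ∀ m → m < l → Arc D (g m) (g (suc m))
        step zero    _ = arc-xy i j e
        step (suc m) _ = arc Y (m + j)
        close : Arc D (g l) (g 0)
        close = arc-yx i (suc l′ + j) (trans (cong F (+-left-comm i (suc l′) j))
          (trans (sym (F-p (suc l′ + (i + j)))) (trans (alternating (l + (i + j))) (cong not f))))
        separate : ∀ a b → a < b → b ≤ l → g a ≢ g b
        separate zero    (suc b) _         _   = x≢y i (b + j)
        separate (suc a) (suc b) (s≤s a<b) b<l = y-window j a<b (≤-trans b<l l≤q)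
        cycle = closedWalk-cycle D l g step close separate

      -- x i → y j → x (1 + i) → y (1 + j) → ⋯ → y (l - 2 + j) → x i
      even-cycle : ∀ i j l → F (i + j) ≡ true → F (l + (i + j)) ≡ false → 2 ≤ l → l ≤ suc q →
        CycleThrough D l (x i) × CycleThrough D l (y j)
      even-cycle i j 1 _ _ (s≤s ()) _
      even-cycle i j 2 e f _ _ with () ← trans (sym e) (trans (sym (F-p (i + j))) f)
      even-cycle i j l@(suc (suc (suc l′))) e f _ l≤1+q =
        cycle 0 z≤n , cycle 1 (s≤s z≤n)
        where
        g : ℕ → Fin n
        g 0 = x i
        g 1 = y j
        g 2 = x (suc i)
        g (suc (suc (suc m))) = y (suc m + j)
        step : ∀ m → m < l → Arc D (g m) (g (suc m))
        step 0 _ = arc-xy i j e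
        step 1 _ = arc-yx (suc i) j (trans (alternating (i + j)) (cong not e))
        step 2 _ = arc-xy (suc i) (suc j) (trans (cong F (+-suc (suc i) j)) (trans (F-p (i + j)) e))
        step (suc (suc (suc m))) _ = arc Y (suc m + j)
        close : Arc D (g l) (g 0)
        close = arc-yx i (suc l′ + j) (trans (cong F (+-left-comm i (suc l′) j))
          (trans (sym (F-p (suc l′ + (i + j)))) f))
        q-bound : ∀ {b} → 3 + b ≤ l → suc b < q
        q-bound b≤l = ≤-pred (≤-trans b≤l l≤1+q)
        xᵢ≢xᵢ₊₁ : x i ≢ x (suc i)
        xᵢ≢xᵢ₊₁ = distinct X i 1 z<s ≤-refl
        separate : ∀ a b → a < b → b ≤ l → g a ≢ g b
        separate 0 1 _ _ = x≢y i j
        separate 0 2 _ _ = xᵢ≢xᵢ₊₁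
        separate 0 (suc (suc (suc b))) _ _ = x≢y i (suc b + j)
        separate 1 2 _ _ = x≢y (suc i) j ∘ sym
        separate 1 (suc (suc (suc b))) _ b≤l = y-window j z<s (q-bound b≤l)
        separate 2 (suc (suc (suc b))) _ _ = x≢y (suc i) (suc b + j)
        separate (suc (suc (suc a))) (suc (suc (suc b))) (s≤s (s≤s (s≤s a<b))) b≤l =
          y-window j (s<s a<b) (q-bound b≤l)
        separate 1 1 (s≤s ()) _
        separate 2 2 (s≤s (s≤s ())) _
        separate 2 1 (s≤s ()) _
        separate (suc (suc (suc _))) 1 (s≤s ()) _
        separate (suc (suc (suc _))) 2 (s≤s (s≤s ())) _
        cycle = closedWalk-cycle D l g step close separate

      pancyclic : Pancyclic
      pancyclic l 2≤l l< = x-through , y-through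
        where
        through : ∀ i j → F (i + j) ≡ true → CycleThrough D l (x i) × CycleThrough D l (y j)
        through i j e with F (l + (i + j)) in f
        ... | true  = odd-cycle i j l e f 2≤l (≤-pred l<)
        ... | false = even-cycle i j l e f 2≤l (≤-pred l<)
        -- By alternation `x i` has an arc to `y 0` or to `y 1`, where either construction can
        -- start.
        x-through : ∀ i → CycleThrough D l (x i)
        x-through i with F (i + 0) in e
        ... | true  = proj₁ (through i 0 e)
        ... | false = proj₁ (through i 1
          (trans (cong F (+-suc i 0)) (trans (alternating (i + 0)) (cong not e))))
        y-through : ∀ j → CycleThrough D l (y j)
        y-through j with F j in e
        ... | true  = proj₂ (through 0 j e)
        ... | false = proj₂ (through 1 j (trans (alternating j) (cong not e)))

    -- Transfer of the explicit cycles to circuits of size 3 and 4.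

    module SmallSizes {u w p′} (u≢w : u ≢ w) (X : Circuit u (suc p′)) (Y : Circuit w (suc p′))
      (G : Vec Bool (suc p′)) (F≡G : ∀ r → Pair.F u≢w X Y (toℕ r) ≡ lookup G r) where

      open Pair u≢w X Y
      open Template G

      ⟦_⟧ : Code p → Fin n
      ⟦ inj₁ i ⟧ = x (toℕ i)
      ⟦ inj₂ j ⟧ = y (toℕ j)

      ⟦⟧-injective : ∀ a b → ⟦ a ⟧ ≡ ⟦ b ⟧ → a ≡ b
      ⟦⟧-injective (inj₁ i) (inj₁ j) e = cong inj₁ (vertex-injective X i j e)
      ⟦⟧-injective (inj₁ i) (inj₂ j) e = contradiction e (x≢y (toℕ i) (toℕ j))
      ⟦⟧-injective (inj₂ i) (inj₁ j) e = contradiction (sym e) (x≢y (toℕ j) (toℕ i))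
      ⟦⟧-injective (inj₂ i) (inj₂ j) e = cong inj₂ (vertex-injective Y i j e)

      F-mod : ∀ m → F m ≡ lookup G (m mod p)
      F-mod m = begin
        F m                      ≡⟨ cong F (trans (m≡m%n+[m/n]*n m p) (+-comm (m % p) (m / p * p))) ⟩
        F (m / p * p + m % p)    ≡⟨ F-multi-p (m / p) (m % p) ⟩
        F (m % p)                ≡⟨ cong F (sym (toℕ-fromℕ< (m%n<n m p))) ⟩
        F (toℕ (m mod p))        ≡⟨ F≡G (m mod p) ⟩
        lookup G (m mod p)       ∎
        where open ≡-Reasoning

      step-next : ∀ {v} (Z : Circuit v p) i → Arc D (vertex Z (toℕ i)) (vertex Z (toℕ (next i)))
      step-next Z i = subst (Arc D _)
        (trans (sym (vertex-% Z (suc (toℕ i)))) (cong (vertex Z) (sym (toℕ-fromℕ< (m%n<n (suc (toℕ i)) p)))))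
        (arc Z (toℕ i))

      ⟦⟧-arc : ∀ a b → a ⟶ b → Arc D ⟦ a ⟧ ⟦ b ⟧
      ⟦⟧-arc (inj₁ i) (inj₁ _) refl = step-next X i
      ⟦⟧-arc (inj₂ j) (inj₂ _) refl = step-next Y j
      ⟦⟧-arc (inj₁ i) (inj₂ j) e    = arc-xy (toℕ i) (toℕ j) (trans (F-mod (toℕ i + toℕ j)) e)
      ⟦⟧-arc (inj₂ j) (inj₁ i) e    = arc-yx (toℕ i) (toℕ j) (trans (F-mod (toℕ i + toℕ j)) e)

      ⟦⟧-cycle : ∀ {l a} (c : Vec (Code p) (suc l)) → CodeCycleThrough a c → CycleThrough D l ⟦ a ⟧
      ⟦⟧-cycle c ((inj , step) , j , e) =
        ⟦_⟧ ∘ lookup c , ((λ {i} {j} e → inj i j (⟦⟧-injective _ _ e)) , λ j → ⟦⟧-arc _ _ (step j)) , j , cong ⟦_⟧ e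

      -- `Spanning` speaks of one period of each circuit; every other index is reduced to it modulo
      -- `p`.
      through : ∀ l (cs : List (Vec (Code p) (suc l))) → Spanning cs →
        (∀ i → CycleThrough D l (x i)) × (∀ j → CycleThrough D l (y j))
      through l cs (x-span , y-span) =
        (λ i → subst (CycleThrough D l) (vertex-mod X i) (pick (x-span (i mod p)))) ,
        (λ j → subst (CycleThrough D l) (vertex-mod Y j) (pick (y-span (j mod p))))
        where
        vertex-mod : ∀ {v} (Z : Circuit v p) i → vertex Z (toℕ (i mod p)) ≡ vertex Z i
        vertex-mod Z i = trans (cong (vertex Z) (toℕ-fromℕ< (m%n<n i p))) (vertex-% Z i)
        pick : ∀ {a} → Any (CodeCycleThrough a) cs → CycleThrough D l ⟦ a ⟧
        pick found = ⟦⟧-cycle (Any.lookup found) (lookup-result found)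

    module _ {u w : Fin k} (u≢w : u ≢ w) where

      pancyclic-3 : (X : Circuit u 3) (Y : Circuit w 3) → let open Pair u≢w X Y in
        F 0 ≡ true → F 1 ≡ false → F 2 ≡ false → Pancyclic
      pancyclic-3 X Y e₀ e₁ e₂ = λ where
          0 () _
          1 (s≤s ()) _
          2 _ _ → through 2 _ spanning-3-3
          3 _ _ → through 3 _ spanning-3-4
          4 _ _ → through 4 _ spanning-3-5
          5 _ _ → through 5 _ spanning-3-6
          (suc (suc (suc (suc (suc (suc _)))))) _ (s≤s (s≤s (s≤s (s≤s (s≤s (s≤s ()))))))
        where
        F≡word : ∀ r → Pair.F u≢w X Y (toℕ r) ≡ lookup word-3 r
        F≡word 0F = e₀
        F≡word 1F = e₁
        F≡word 2F = e₂
        open SmallSizes u≢w X Y word-3 F≡word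

      pancyclic-4 : (X : Circuit u 4) (Y : Circuit w 4) → let open Pair u≢w X Y in
        F 0 ≡ true → F 1 ≡ false → F 2 ≡ false → F 3 ≡ true → Pancyclic
      pancyclic-4 X Y e₀ e₁ e₂ e₃ = λ where
          0 () _
          1 (s≤s ()) _
          2 _ _ → through 2 _ spanning-4-3
          3 _ _ → through 3 _ spanning-4-4
          4 _ _ → through 4 _ spanning-4-5
          5 _ _ → through 5 _ spanning-4-6
          6 _ _ → through 6 _ spanning-4-7
          7 _ _ → through 7 _ spanning-4-8
          (suc (suc (suc (suc (suc (suc (suc (suc _)))))))) _ (s≤s (s≤s (s≤s (s≤s (s≤s (s≤s (s≤s (s≤s ()))))))))
        where
        F≡word : ∀ r → Pair.F u≢w X Y (toℕ r) ≡ lookup word-4 r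
        F≡word 0F = e₀
        F≡word 1F = e₁
        F≡word 2F = e₂
        F≡word 3F = e₃
        open SmallSizes u≢w X Y word-4 F≡word

    -- Normalisation of the word and the case distinction on sizes.

    module _ {u w p q} (u≢w : u ≢ w) (X : Circuit u p) (Y : Circuit w q) where
      open Pair using (Pancyclic)

      -- Rotating `Y` shifts the word, so a drop can be moved to index 0, while the set of vertices
      -- to be covered stays the same.
      unrotate : ∀ s → Pancyclic u≢w X (rotate s Y) → Pancyclic u≢w X Y
      unrotate s cycles l 2≤l l< = proj₁ (cycles l 2≤l l<) , λ j →
        let j′ , e = rotate-covers s Y j in subst (CycleThrough D l) e (proj₂ (cycles l 2≤l l<) j′)

      transpose : Pancyclic (u≢w ∘ sym) Y X → Pancyclic u≢w X Y
      transpose cycles l 2≤l l< = swap (cycles l 2≤l (subst (suc l ≤_) (+-comm p q) l<))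

    equal-sizes-pancyclic : ∀ {u w p} (u≢w : u ≢ w) (X : Circuit u p) (Y : Circuit w p) →
      3 ≤ p → p < 5 → Pair.Pancyclic u≢w X Y
    equal-sizes-pancyclic {p = 3} u≢w X Y _ _ with Pair.drop u≢w X Y
    ... | s , e₀ , e₁ with Pair.F u≢w X Y (2 + s) in e₂
    ...   | false = unrotate u≢w X Y s (pancyclic-3 u≢w X (rotate s Y) e₀ e₁ e₂)
    -- The word reads true, false, true from `s`. Seen from `Y` it is complemented, and from `1 + s`
    -- on it reads true, false, false.
    ...   | true  = transpose u≢w X Y (unrotate (u≢w ∘ sym) Y X (1 + s)
      (pancyclic-3 (u≢w ∘ sym) Y (rotate (1 + s) X)
        (flip (1 + s) e₁) (flip (2 + s) e₂) (flip (3 + s) (trans (F-p s) e₀))))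
      where
      open Pair u≢w X Y
      flip : ∀ m {b} → F m ≡ b → D (y 0) (x m) ≡ not b
      flip m e = trans (diagonal-reverse m 0) (cong not (trans (cong F (+-identityʳ m)) e))
    equal-sizes-pancyclic {p = 4} u≢w X Y _ _ with Pair.drop u≢w X Y
    ... | s , e₀ , e₁ = unrotate u≢w X Y s
      (pancyclic-4 u≢w X (rotate s Y) e₀ e₁ (opposite s e₀) (opposite (1 + s) e₁))
      where
      open Pair u≢w X Y
      -- With `a = b = 2` the last corner `F (4 + m)` is `F m` by periodicity, so `F m = F (2 + m)`
      -- would complete a rectangle.
      opposite : ∀ m {b} → F m ≡ b → F (2 + m) ≡ not b
      opposite m e = trans (≢⇒≡not λ f → no-rectangle m 2 2 z<s (s≤s (s≤s (s≤s z≤n))) z<s (s≤s (s≤s (s≤s z≤n)))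
        (f , f , sym (F-p m))) (cong not e)
    equal-sizes-pancyclic {p = suc (suc (suc (suc (suc _))))} _ _ _ _ (s≤s (s≤s (s≤s (s≤s (s≤s ())))))
    equal-sizes-pancyclic {p = 1} _ _ _ (s≤s ()) _
    equal-sizes-pancyclic {p = 2} _ _ _ (s≤s (s≤s ())) _

    pancyclic : ∀ {u w p q} (u≢w : u ≢ w) (X : Circuit u p) (Y : Circuit w q) → Pair.Pancyclic u≢w X Y
    pancyclic {p = p} {q} u≢w X Y with m≤n⇒m<n∨m≡n (2≤size X) | m≤n⇒m<n∨m≡n (2≤size Y) | <-cmp p q
    ... | inj₂ refl | _         | _               = SizeTwo.pancyclic u≢w X Y
    ... | inj₁ _    | inj₂ refl | _               = transpose u≢w X Y (SizeTwo.pancyclic (u≢w ∘ sym) Y X)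
    ... | inj₁ 3≤p  | inj₁ _    | tri< p<q _ _    = contradiction p<q (Pair.≮q u≢w X Y 3≤p)
    ... | inj₁ _    | inj₁ 3≤q  | tri> _ _ q<p    = contradiction q<p (Pair.≮q (u≢w ∘ sym) Y X 3≤q)
    ... | inj₁ 3≤p  | inj₁ _    | tri≈ _ refl _   = equal-sizes-pancyclic u≢w X Y 3≤p (Pair.<5 u≢w X Y refl)

    -- Exclusion of a third summand.

    -- Otherwise x 0, z, y, x 1 is a good cycle.
    no-arc : ∀ {u p} (X : Circuit u p) {y z} → u ≢ part y → u ≢ part z → y ≢ z →
      Arc D (vertex X 0) z → Arc D y (vertex X 1) → ¬ Arc D y z
    no-arc {u} X {y} {z} y∉u z∉u y≢z x₀z yx₁ yz = noGood (vertex X 0) z y (vertex X 1)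
      (((≢x 0 z∉u , ≢x 0 y∉u , distinct X 0 1 z<s (2≤size X) , y≢z ∘ sym , ≢x 1 z∉u ∘ sym , ≢x 1 y∉u ∘ sym)
      , x₀z , arc X 0 , yz , yx₁)
      , inj₁ ((x₀z , part≢ 0 z∉u) , (yx₁ , part≢ 1 y∉u ∘ sym)))
      where
      part≢ : ∀ i {v} → u ≢ part v → part (vertex X i) ≢ part v
      part≢ i v∉u e = v∉u (trans (sym (inPart X i)) e)
      ≢x : ∀ i {v} → u ≢ part v → vertex X i ≢ v
      ≢x i v∉u e = part≢ i v∉u (cong part e)

    -- The vertices `y` and `z` both lie between `x 0` and `x 1`, so their roles are symmetric and
    -- `no-arc` refutes either direction of the arc joining them.
    no-three-circuits : ∀ {u v w p q r} → u ≢ v → u ≢ w → v ≢ w →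
      Circuit u p → Circuit v q → Circuit w r → ⊥
    no-three-circuits u≢v u≢w v≢w X Y Z
      with Pair.between u≢v X Y | Pair.between u≢w X Z
    ... | j , x₀y , yx₁ | k , x₀z , zx₁ =
      [ no-arc X y∉u z∉u (Pair.x≢y v≢w Y Z j k) x₀z yx₁
      , no-arc X z∉u y∉u (Pair.x≢y v≢w Y Z j k ∘ sym) x₀y zx₁ ]′
      (proj₁ (sum (vertex Y j) (vertex Z k) (Pair.exterior v≢w Y Z j k)))
      where
      y∉u : _ ≢ part (vertex Y j)
      y∉u e = u≢v (trans e (inPart Y j))
      z∉u : _ ≢ part (vertex Z k)
      z∉u e = u≢w (trans e (inPart Z k))


-- Reduction of the theorem to two circuits covering all vertices.

theorem3 : (n k : ℕ) → 2 ≤ k → (D : Digraph n) → Loopless D → (part : Fin n → Fin k) → IsGeneralizedSum D part → ((i : Fin k) → SummandHamiltonian D part i) → Strong D → NoGoodCycle D part → VertexPancyclic D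
theorem3 n 0 () D _ part sum hamiltonian _ noGood
theorem3 n 1 (s≤s ()) D _ part sum hamiltonian _ noGood
theorem3 n (suc (suc (suc k))) _ D _ part sum hamiltonian _ noGood =
  ⊥-elim (no-three-circuits {0F} {1F} {2F} (λ ()) (λ ()) (λ ()) (circuit 0F) (circuit 1F) (circuit 2F))
  where
  open NoGood D part sum noGood
  circuit : ∀ u → Circuit D part u (proj₁ (summand-circuit D part (hamiltonian u)))
  circuit u = proj₁ (proj₂ (summand-circuit D part (hamiltonian u)))
theorem3 n 2 _ D _ part sum hamiltonian _ noGood
  with summand-circuit D part (hamiltonian 0F) | summand-circuit D part (hamiltonian 1F)
... | p , X , X-covers | q , Y , Y-covers = 3≤n , λ v l 2≤l l<n →
  through v (cycles l 2≤l (≤-trans l<n n≤p+q))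
  where
  open NoGood D part sum noGood
  open Circuit

  cycles : Pair.Pancyclic {0F} {1F} (λ ()) X Y
  cycles = pancyclic (λ ()) X Y

  -- A cycle with `l = 2` has three distinct vertices, and it is available because `p + q` is at
  -- least 4.
  3≤n : 3 ≤ n
  3≤n with proj₁ (cycles 2 ≤-refl (<⇒≤ (+-mono-≤ (2≤size X) (2≤size Y)))) 0
  ... | _ , (injective , _) , _ = injective⇒≤ injective

  decode : Fin p ⊎ Fin q → Fin n
  decode = [ vertex X ∘ toℕ , vertex Y ∘ toℕ ]′

  decode-surjective : ∀ v → ∃ λ c → decode c ≡ v
  decode-surjective v with part v in v∈
  ... | 0F = let i , i<p , e = X-covers v v∈ in
    inj₁ (fromℕ< i<p) , trans (cong (vertex X) (toℕ-fromℕ< i<p)) e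
  ... | 1F = let j , j<q , e = Y-covers v v∈ in
    inj₂ (fromℕ< j<q) , trans (cong (vertex Y) (toℕ-fromℕ< j<q)) e

  through : ∀ {l} v → (∀ i → CycleThrough D l (vertex X i)) × (∀ j → CycleThrough D l (vertex Y j)) →
    CycleThrough D l v
  through {l} v (x-through , y-through) with decode-surjective v
  ... | inj₁ i , e = subst (CycleThrough D l) e (x-through (toℕ i))
  ... | inj₂ j , e = subst (CycleThrough D l) e (y-through (toℕ j))

  -- This puts every length up to `n` within the range covered by `cycles`.
  n≤p+q : n ≤ p + q
  n≤p+q = surjective⇒≤ decode decode-surjective
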